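{- Let $\mathbf{k}$ be a commutative ring in which $2$ is invertible. Then the family $(\eta_\alpha)_{n\in\mathbb{N},\ \alpha\in\operatorname{Comp}(n)}$ of enriched monomial functions is a basis of the $\mathbf{k}$-module $\operatorname{QSym}$.
   Context: $\mathbb{N}=\{0,1,2,\ldots\}$, $[n]=\{1,\ldots,n\}$ (empty if $n\le 0$). A composition of $n\in\mathbb{N}$ is a finite sequence $\alpha=(\alpha_1,\ldots,\alpha_p)$ of positive integers with sum $n$; its length is $\ell(\alpha)=p$. $\operatorname{Comp}(n)$ is the set of compositions of $n$ (for $n=0$, only the empty composition). For $\alpha\in\operatorname{Comp}(n)$, $\operatorname{Des}(\alpha)=\{\alpha_1,\alpha_1+\alpha_2,\ldots,\alpha_1+\cdots+\alpha_{p-1}\}\subseteq[n-1]$. $\operatorname{QSym}$ is the ring of quasisymmetric functions over $\mathbf{k}$: the $\mathbf{k}$-subalgebra of $\mathbf{k}[[x_1,x_2,x_3,\ldots]]$ consisting of the bounded-degree power series in which, for all non-negative integers $\alpha_1,\ldots,\alpha_p$ and all $i_1<\cdots<i_p$, the coefficients of $x_1^{\alpha_1}\cdots x_p^{\alpha_p}$ and $x_{i_1}^{\alpha_1}\cdots x_{i_p}^{\alpha_p}$ are equal. For a composition $\alpha$, the monomial quasisymmetric function is $M_\alpha=\sum_{i_1<\cdots<i_p}x_{i_1}^{\alpha_1}\cdots x_{i_p}^{\alpha_p}$ (indices are positive integers); the $M_\alpha$ form a basis of the $\mathbf{k}$-module $\operatorname{QSym}$. For $\alpha\in\operatorname{Comp}(n)$,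 the enriched monomial function is $\eta_\alpha=\sum_{\beta\in\operatorname{Comp}(n),\ \operatorname{Des}(\beta)\subseteq\operatorname{Des}(\alpha)}2^{\ell(\beta)}M_\beta$. -}

module Defs where

open import Algebra.Bundles using (CommutativeRing)
open import Algebra.Module.Bundles using (Module)
open import Algebra.Module.Bundles.Raw using (RawModule)
import Algebra.Properties.CommutativeSemigroup as CommutativeSemigroup
import Algebra.Module.Morphism.ModuleMonomorphism as ModuleMonomorphism
import Algebra.Module.Morphism.Structures as ModuleMorphisms
import Algebra.Module.Structures.Biased as Biased
import Algebra.Properties.Ring as RingProperties
import Algebra.Properties.Semiring.Exp as SemiringExp
import Algebra.Properties.Semiring.Mult as SemiringMult
open import Data.Bool.Base using (if_then_else_)
open import Data.Bool.Properties using (if-eta)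
open import Data.Empty using (⊥-elim)
open import Data.Fin.Base as Fin using (Fin; toℕ)
open import Data.List.Base as List
  using (List; []; _∷_; applyUpTo; cartesianProductWith; concatMap; filter; foldr; length; map; take; upTo)
open import Data.List.Membership.Propositional using (_∈_)
open import Data.List.Membership.Propositional.Properties
  using (∈-cartesianProductWith⁺; ∈-concatMap⁺; ∈-filter⁺; ∈-filter⁻; ∈-upTo⁺)
import Data.List.Relation.Unary.All.Properties as All
import Data.List.Relation.Unary.AllPairs as AllPairs
import Data.List.Relation.Unary.AllPairs.Properties as AllPairs
import Data.List.Relation.Binary.Subset.DecPropositional as DecSubset
open import Data.List.Relation.Unary.All as All using (All; []; _∷_)
open import Data.List.Relation.Unary.AllPairs using ([]; _∷_)
open import Data.List.Relation.Unary.Any as Any using (here; there)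
open import Data.List.Relation.Unary.Unique.Propositional using (Unique)
import Data.List.Relation.Unary.Unique.Propositional.Properties as Unique
open import Data.Nat.Base as ℕ using (ℕ; zero; suc; NonZero; _≤_; _<_; z≤n; s≤s; _⊔_)
open import Data.Nat.ListAction using (sum)
import Data.Nat.Properties as ℕ
open import Data.Product.Base using (Σ; ∃; _×_; _,_; proj₁; proj₂)
open import Data.Vec.Base as Vec using (Vec; []; _∷_)
import Data.Vec.Properties as Vec
open import Data.Vec.Relation.Unary.All using ([]; _∷_) renaming (All to VecAll)
open import Data.Vec.Relation.Unary.Linked using (Linked; []; [-]; _∷_; linked?)
open import Function.Base using (_∘_)
open import Level using () renaming (_⊔_ to _⊔ˡ_)
open import Relation.Binary.Definitions using (tri<; tri≈; tri>)
open import Relation.Binary.PropositionalEquality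
  using (_≡_; _≢_; refl; sym; trans; cong; cong₂; subst)
open import Relation.Nullary using (Dec; yes; no; does)
open import Relation.Nullary.Decidable using (dec-false; dec-true; map′; recompute)

private
  variable
    n p : ℕ

-- The proofs are irrelevant, so that compositions with equal parts are equal.

record Comp (n : ℕ) : Set where
  constructor composition
  field
    parts     : List ℕ
    .positive : All NonZero parts
    .sums     : sum parts ≡ n

open Comp public using (parts)

ℓ : Comp n → ℕ
ℓ α = length (parts α)

vector : (α : Comp n) → Vec ℕ (ℓ α)
vector α = Vec.fromList (parts α)

Des : Comp n → List ℕ
Des α = map (λ k → sum (take (suc k) (parts α))) (upTo (ℓ α ℕ.∸ 1))

open DecSubset ℕ._≟_ public using (_⊆_; _⊆?_)

-- The compositions of n + 1 are obtained from those of n by either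
-- prepending a part 1 or increasing the first part by 1.

grow : Comp n → List (Comp (suc n))
grow (composition [] pos s) =
  composition (1 ∷ []) (_ ∷ []) (cong suc s) ∷ []
grow (composition (a ∷ as) pos s) =
  composition (1 ∷ a ∷ as) (_ ∷ pos) (cong suc s) ∷
  composition (suc a ∷ as) (_ ∷ All.tail pos) (cong suc s) ∷ []

compositions : ∀ n → List (Comp n)
compositions zero    = composition [] [] refl ∷ []
compositions (suc n) = concatMap grow (compositions n)

positive-head : ∀ {as} {A : Set} → .(All NonZero (zero ∷ as)) → A
positive-head pos with () ∷ _ ← recompute (All.all? ℕ.nonZero? _) pos

grow-complete : (α : Comp (suc n)) → ∃ λ β → α ∈ grow β
grow-complete (composition [] pos s) with () ← recompute (_ ℕ.≟ _) s
grow-complete (composition (zero ∷ as) pos s) = positive-head pos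
grow-complete (composition (suc zero ∷ []) pos s) =
  composition [] [] (ℕ.suc-injective s) , here refl
grow-complete (composition (suc zero ∷ a ∷ as) pos s) =
  composition (a ∷ as) (All.tail pos) (ℕ.suc-injective s) , here refl
grow-complete (composition (suc (suc a) ∷ as) pos s) =
  composition (suc a ∷ as) (_ ∷ All.tail pos) (ℕ.suc-injective s) , there (here refl)

grow-unique : (α : Comp n) → Unique (grow α)
grow-unique (composition [] pos s) = [] ∷ []
grow-unique (composition (zero ∷ as) pos s) = positive-head pos
grow-unique (composition (suc a ∷ as) pos s) = ((λ ()) ∷ []) ∷ [] ∷ []

grow-injective : ∀ {α β : Comp n} {γ} → γ ∈ grow α → γ ∈ grow β → α ≡ β
grow-injective {α = composition [] _ _} {composition [] _ _} _ _ = refl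
grow-injective {α = composition [] _ _} {composition (a ∷ as) pos _} (here refl) (there (here refl)) =
  positive-head pos
grow-injective {α = composition (a ∷ as) pos _} {composition [] _ _} (there (here refl)) (here refl) =
  positive-head pos
grow-injective {α = composition (a ∷ as) _ _} {composition (b ∷ bs) _ _} (here refl) (here refl) = refl
grow-injective {α = composition (a ∷ as) _ _} {composition (b ∷ bs) pos _} (here refl) (there (here refl)) =
  positive-head pos
grow-injective {α = composition (a ∷ as) pos _} {composition (b ∷ bs) _ _} (there (here refl)) (here refl) =
  positive-head pos
grow-injective {α = composition (a ∷ as) _ _} {composition (b ∷ bs) _ _}
  (there (here refl)) (there (here refl)) = refl

compositions-complete : (α : Comp n) → α ∈ compositions n
compositions-complete {zero} (composition [] pos s) = here refl
compositions-complete {zero} (composition (zero ∷ as) pos s) = positive-head pos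
compositions-complete {zero} (composition (suc a ∷ as) pos s) with () ← recompute (_ ℕ.≟ _) s
compositions-complete {suc n} α with β , α∈ ← grow-complete α =
  ∈-concatMap⁺ grow (Any.map (λ { refl → α∈ }) (compositions-complete β))

compositions-unique : ∀ n → Unique (compositions n)
compositions-unique zero    = [] ∷ []
compositions-unique (suc n) = Unique.concat⁺
  (All.map⁺ (All.universal grow-unique (compositions n)))
  (AllPairs.map⁺ (AllPairs.map (λ α≢β {γ} γ∈ → α≢β (grow-injective (proj₁ γ∈) (proj₂ γ∈)))
    (compositions-unique n)))

-- The variables x₁, x₂, … are indexed from 0: the index i stands for xᵢ₊₁.

record Monomial : Set where
  field
    exponent : ℕ → ℕ
    bound    : ℕ
    finite   : ∀ k → bound ≤ k → exponent k ≡ 0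

open Monomial public

infix 4 _≈ₘ_ _≈ₘ?_

_≈ₘ_ : Monomial → Monomial → Set
m ≈ₘ m′ = ∀ k → exponent m k ≡ exponent m′ k

_≈ₘ?_ : ∀ m m′ → Dec (m ≈ₘ m′)
m ≈ₘ? m′ = map′ everywhere (λ eq {k} _ → eq k)
  (ℕ.allUpTo? (λ k → exponent m k ℕ.≟ exponent m′ k) (bound m ⊔ bound m′))
  where
  everywhere : (∀ {k} → k < bound m ⊔ bound m′ → exponent m k ≡ exponent m′ k) → m ≈ₘ m′
  everywhere eq k with k ℕ.<? bound m ⊔ bound m′
  ... | yes k<b = eq k<b
  ... | no  k≮b = trans
    (finite m k (ℕ.≤-trans (ℕ.m≤m⊔n _ _) (ℕ.≮⇒≥ k≮b)))
    (sym (finite m′ k (ℕ.≤-trans (ℕ.m≤n⊔m (bound m) _) (ℕ.≮⇒≥ k≮b))))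

degree : Monomial → ℕ
degree m = sum (applyUpTo (exponent m) (bound m))

one : Monomial
one = record { exponent = λ _ → 0 ; bound = 0 ; finite = λ _ _ → refl }

infixl 7 _·_

_·_ : Monomial → Monomial → Monomial
m · m′ = record
  { exponent = λ k → exponent m k ℕ.+ exponent m′ k
  ; bound    = bound m ⊔ bound m′
  ; finite   = λ k b≤k → cong₂ ℕ._+_
      (finite m k (ℕ.≤-trans (ℕ.m≤m⊔n _ _) b≤k))
      (finite m′ k (ℕ.≤-trans (ℕ.m≤n⊔m (bound m) _) b≤k))
  }

powerExponent : ℕ → ℕ → ℕ → ℕ
powerExponent i a k = if does (k ℕ.≟ i) then a else 0

powerExponent-≡ : ∀ i a → powerExponent i a i ≡ a
powerExponent-≡ i a = cong (if_then a else 0) (dec-true (i ℕ.≟ i) refl)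

powerExponent-≢ : ∀ i a k → k ≢ i → powerExponent i a k ≡ 0
powerExponent-≢ i a k k≢i = cong (if_then a else 0) (dec-false (k ℕ.≟ i) k≢i)

variablePower : ℕ → ℕ → Monomial
variablePower i a = record
  { exponent = powerExponent i a
  ; bound    = suc i
  ; finite   = λ k i<k → powerExponent-≢ i a k (ℕ.>⇒≢ i<k)
  }

infix 8 x[_]^_

x[_]^_ : Vec ℕ p → Vec ℕ p → Monomial
x[ [] ]^ []           = one
x[ i ∷ is ]^ (a ∷ as) = variablePower i a · x[ is ]^ as

Increasing : Vec ℕ p → Set
Increasing = Linked _<_

-- The indices of x₁, …, xₚ.

initial : ∀ p → Vec ℕ p
initial p = Vec.tabulate toℕ

vectors : ∀ p → ℕ → List (Vec ℕ p)
vectors zero    b = [] ∷ []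
vectors (suc p) b = cartesianProductWith _∷_ (upTo b) (vectors p b)

increasing : ∀ p → ℕ → List (Vec ℕ p)
increasing p b = filter (linked? ℕ._<?_) (vectors p b)

-- All i₁ < ⋯ < iₚ with x_{i₁}^{α₁} ⋯ x_{iₚ}^{αₚ} = m. As the αⱼ are positive,
-- such iⱼ lie below any bound on the variables occurring in m, so nothing is
-- lost by searching below it (occurrences-complete).

occurrences : (α : Comp n) → Monomial → List (Vec ℕ (ℓ α))
occurrences α m =
  filter (λ i → x[ i ]^ vector α ≈ₘ? m) (increasing (ℓ α) (bound m))

-- A product of powers of variables, as a list of (index , exponent) pairs.

Terms : Set
Terms = List (ℕ × ℕ)

terms : Vec ℕ p → Vec ℕ p → Terms
terms []       []       = []
terms (i ∷ is) (a ∷ as) = (i , a) ∷ terms is as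

value : Terms → ℕ → ℕ
value []            k = 0
value ((i , a) ∷ t) k = powerExponent i a k ℕ.+ value t k

value-terms : ∀ (i α : Vec ℕ p) k → exponent (x[ i ]^ α) k ≡ value (terms i α) k
value-terms []       []       k = refl
value-terms (i ∷ is) (a ∷ as) k = cong (powerExponent i a k ℕ.+_) (value-terms is as k)

data Ascending : ℕ → Terms → Set where
  []  : ∀ {b} → Ascending b []
  _∷_ : ∀ {b i a t} → b ≤ i → Ascending (suc i) t → Ascending b ((i , a) ∷ t)

weaken : ∀ {b b′ t} → b ≤ b′ → Ascending b′ t → Ascending b t
weaken b≤ []        = []
weaken b≤ (≤i ∷ as) = ℕ.≤-trans b≤ ≤i ∷ as

ascending-∷ : ∀ {b} {i : ℕ} {is : Vec ℕ p} {α : Vec ℕ (suc p)} →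
              b ≤ i → Increasing (i ∷ is) → Ascending b (terms (i ∷ is) α)
ascending-∷ {α = _ ∷ []}    b≤i [-]         = b≤i ∷ []
ascending-∷ {is = _ ∷ _} {α = _ ∷ α} b≤i (i<j ∷ js) = b≤i ∷ ascending-∷ {α = α} i<j js

ascending : {i α : Vec ℕ p} → Increasing i → Ascending 0 (terms i α)
ascending {i = []}     {[]}    _  = []
ascending {i = _ ∷ _} {α = α} is = ascending-∷ {α = α} z≤n is

increasing⁻ : ∀ {b} {i α : Vec ℕ p} → Ascending b (terms i α) → Increasing i
increasing⁻ {i = []}        {[]}        _                  = []
increasing⁻ {i = _ ∷ []}    {_ ∷ []}    _                  = [-]
increasing⁻ {i = _ ∷ _ ∷ _} {_ ∷ _ ∷ _} (_ ∷ as@(i<j ∷ _)) = i<j ∷ increasing⁻ as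

nonzeros : Terms → Terms
nonzeros []                = []
nonzeros ((i , zero) ∷ t)  = nonzeros t
nonzeros ((i , suc a) ∷ t) = (i , suc a) ∷ nonzeros t

Positive : Terms → Set
Positive = All (NonZero ∘ proj₂)

nonzeros-positive : ∀ t → Positive (nonzeros t)
nonzeros-positive []                = []
nonzeros-positive ((i , zero) ∷ t)  = nonzeros-positive t
nonzeros-positive ((i , suc a) ∷ t) = _ ∷ nonzeros-positive t

nonzeros-ascending : ∀ {b t} → Ascending b t → Ascending b (nonzeros t)
nonzeros-ascending []                               = []
nonzeros-ascending (_∷_ {a = zero} b≤i as)          =
  weaken (ℕ.m≤n⇒m≤1+n b≤i) (nonzeros-ascending as)
nonzeros-ascending (_∷_ {a = suc a} b≤i as)         = b≤i ∷ nonzeros-ascending as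

powerExponent-0 : ∀ i k → powerExponent i 0 k ≡ 0
powerExponent-0 i k = if-eta (does (k ℕ.≟ i))

value-nonzeros : ∀ t k → value (nonzeros t) k ≡ value t k
value-nonzeros []                k = refl
value-nonzeros ((i , zero) ∷ t)  k =
  trans (value-nonzeros t k) (cong (ℕ._+ value t k) (sym (powerExponent-0 i k)))
value-nonzeros ((i , suc a) ∷ t) k = cong (powerExponent i (suc a) k ℕ.+_) (value-nonzeros t k)

nonzeros-exponents : ∀ {i j α : Vec ℕ p} →
  map proj₂ (nonzeros (terms i α)) ≡ map proj₂ (nonzeros (terms j α))
nonzeros-exponents {i = []}    {[]}    {[]}        = refl
nonzeros-exponents {i = _ ∷ i} {_ ∷ j} {zero ∷ α}  = nonzeros-exponents {i = i} {j} {α}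
nonzeros-exponents {i = _ ∷ i} {_ ∷ j} {suc a ∷ α} =
  cong (suc a ∷_) (nonzeros-exponents {i = i} {j} {α})

value-below : ∀ {b t k} → Ascending b t → k < b → value t k ≡ 0
value-below []                               k<b = refl
value-below (_∷_ {i = i} {a} {t} b≤i as) k<b = cong₂ ℕ._+_
  (powerExponent-≢ i a _ (ℕ.<⇒≢ (ℕ.<-≤-trans k<b b≤i)))
  (value-below as (ℕ.m<n⇒m<1+n (ℕ.<-≤-trans k<b b≤i)))

value-head : ∀ {i a t} → Ascending (suc i) t → value ((i , a) ∷ t) i ≡ a
value-head {i} {a} as = trans
  (cong₂ ℕ._+_ (powerExponent-≡ i a) (value-below as ℕ.≤-refl)) (ℕ.+-identityʳ a)

value-injective : ∀ {b c s t} → Ascending b s → Ascending c t → Positive s → Positive t →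
                  (∀ k → value s k ≡ value t k) → s ≡ t
value-injective [] [] _ _ _ = refl
value-injective [] (_∷_ {i = i} {a} _ as) _ (a≢0 ∷ _) eq =
  ⊥-elim (ℕ.≢-nonZero⁻¹ a {{a≢0}} (sym (trans (eq i) (value-head as))))
value-injective (_∷_ {i = i} {a} _ as) [] (a≢0 ∷ _) _ eq =
  ⊥-elim (ℕ.≢-nonZero⁻¹ a {{a≢0}} (trans (sym (value-head as)) (eq i)))
value-injective (_∷_ {i = i} {a} _ as) (_∷_ {i = j} {c} _ cs) (a≢0 ∷ ps) (c≢0 ∷ qs) eq
  with ℕ.<-cmp i j
... | tri< i<j _ _ = ⊥-elim (ℕ.≢-nonZero⁻¹ a {{a≢0}}
  (trans (sym (value-head as)) (trans (eq i) (value-below (ℕ.≤-refl {j} ∷ cs) i<j))))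
... | tri> _ _ j<i = ⊥-elim (ℕ.≢-nonZero⁻¹ c {{c≢0}}
  (trans (sym (value-head cs)) (trans (sym (eq j)) (value-below (ℕ.≤-refl {i} ∷ as) j<i))))
... | tri≈ _ refl _ with refl ← trans (sym (value-head as)) (trans (eq i) (value-head cs)) =
  cong ((i , a) ∷_) (value-injective as cs ps qs
    (λ k → ℕ.+-cancelˡ-≡ (powerExponent i a k) _ _ (eq k)))

terms-injective : ∀ {i j α : Vec ℕ p} → terms i α ≡ terms j α → i ≡ j
terms-injective {i = []}    {[]}    {[]}    _  = refl
terms-injective {i = i ∷ is} {j ∷ js} {a ∷ α} eq =
  cong₂ _∷_ (cong headIndex eq) (terms-injective (cong (List.drop 1) eq))
  where
  headIndex : Terms → ℕ
  headIndex []            = 0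
  headIndex ((i , _) ∷ _) = i

terms-exponents : ∀ (i α : Vec ℕ p) → map proj₂ (terms i α) ≡ Vec.toList α
terms-exponents []       []       = refl
terms-exponents (i ∷ is) (a ∷ as) = cong (a ∷_) (terms-exponents is as)

indices : (t : Terms) → Vec ℕ (length (map proj₂ t))
indices []            = []
indices ((i , _) ∷ t) = i ∷ indices t

terms-indices : ∀ t → terms (indices t) (Vec.fromList (map proj₂ t)) ≡ t
terms-indices []            = refl
terms-indices ((i , a) ∷ t) = cong ((i , a) ∷_) (terms-indices t)

terms-positive : ∀ {i α : Vec ℕ p} → All NonZero (Vec.toList α) → Positive (terms i α)
terms-positive {i = []}    {[]}    []       = []
terms-positive {i = _ ∷ _} {_ ∷ _} (p ∷ ps) = p ∷ terms-positive ps

toList-fromList : ∀ (as : List ℕ) → Vec.toList (Vec.fromList as) ≡ as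
toList-fromList = Vec.toList∘fromList

parts-positive : (α : Comp n) → All NonZero (parts α)
parts-positive (composition _ pos _) = recompute (All.all? ℕ.nonZero? _) pos

vector-positive : (α : Comp n) → All NonZero (Vec.toList (vector α))
vector-positive α = subst (All NonZero) (sym (toList-fromList (parts α))) (parts-positive α)

record Occurs (α : Comp n) (m : Monomial) : Set where
  constructor occurs
  field
    {index} : Vec ℕ (ℓ α)
    isIncreasing : Increasing index
    equal : x[ index ]^ vector α ≈ₘ m

vectors-complete : ∀ {b} {i : Vec ℕ p} → VecAll (_< b) i → i ∈ vectors p b
vectors-complete []         = here refl
vectors-complete (i< ∷ is<) = ∈-cartesianProductWith⁺ _∷_ (∈-upTo⁺ i<) (vectors-complete is<)

vectors-unique : ∀ p b → Unique (vectors p b)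
vectors-unique zero    b = [] ∷ []
vectors-unique (suc p) b =
  Unique.cartesianProductWith⁺ _∷_ Vec.∷-injective (Unique.upTo⁺ b) (vectors-unique p b)

indices-bounded : ∀ {b} {i α : Vec ℕ p} → All NonZero (Vec.toList α) →
                  (∀ k → b ≤ k → exponent (x[ i ]^ α) k ≡ 0) → VecAll (_< b) i
indices-bounded {i = []}    {[]}       []       fin = []
indices-bounded {b = b} {i = i ∷ is} {a ∷ as} (a≢0 ∷ ps) fin with i ℕ.<? b
... | yes i<b = i<b ∷ indices-bounded ps (λ k b≤k → ℕ.m+n≡0⇒n≡0 (powerExponent i a k) (fin k b≤k))
... | no  i≮b = ⊥-elim (ℕ.≢-nonZero⁻¹ a {{a≢0}} (trans (sym (powerExponent-≡ i a))
  (ℕ.m+n≡0⇒m≡0 (powerExponent i a i) (fin i (ℕ.≮⇒≥ i≮b)))))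

occurrences-complete : ∀ (α : Comp n) m {i} → Increasing i →
                       x[ i ]^ vector α ≈ₘ m → i ∈ occurrences α m
occurrences-complete α m inc eq =
  ∈-filter⁺ _ (∈-filter⁺ _ (vectors-complete (indices-bounded (vector-positive α)
    (λ k b≤k → trans (eq k) (finite m k b≤k)))) inc) eq

occurrences-sound : ∀ (α : Comp n) m {i} → i ∈ occurrences α m →
                    Increasing i × x[ i ]^ vector α ≈ₘ m
occurrences-sound α m i∈ with i∈inc , eq ← ∈-filter⁻ (λ i → x[ i ]^ vector α ≈ₘ? m) i∈
  = proj₂ (∈-filter⁻ (linked? ℕ._<?_) {xs = vectors (ℓ α) (bound m)} i∈inc) , eq

occurrences-unique : ∀ (α : Comp n) m → Unique (occurrences α m)
occurrences-unique α m = Unique.filter⁺ _ (Unique.filter⁺ _ (vectors-unique _ _))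

occurs-unique : ∀ (α : Comp n) {m i j} →
  Increasing i → x[ i ]^ vector α ≈ₘ m → Increasing j → x[ j ]^ vector α ≈ₘ m → i ≡ j
occurs-unique α {m} {i} {j} i↑ i≈ j↑ j≈ = terms-injective (value-injective
  (ascending i↑) (ascending j↑)
  (terms-positive (vector-positive α)) (terms-positive (vector-positive α))
  (λ k → trans (sym (value-terms i _ k)) (trans (i≈ k) (trans (sym (j≈ k)) (value-terms j _ k)))))

length-cong : ∀ {A : Set} {xs ys : List A} → Unique xs → Unique ys →
  (∀ {x y} → x ∈ xs → y ∈ xs → x ≡ y) → (∀ {x y} → x ∈ ys → y ∈ ys → x ≡ y) →
  (∀ {x} → x ∈ xs → ∃ (_∈ ys)) → (∀ {y} → y ∈ ys → ∃ (_∈ xs)) → length xs ≡ length ys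
length-cong {xs = []} {[]} _ _ _ _ _ _ = refl
length-cong {xs = []} {_ ∷ _} _ _ _ _ _ g with () ← proj₂ (g (here refl))
length-cong {xs = _ ∷ _} {[]} _ _ _ _ f _ with () ← proj₂ (f (here refl))
length-cong {xs = _ ∷ []} {_ ∷ []} _ _ _ _ _ _ = refl
length-cong {xs = _ ∷ _ ∷ _} ((x≢ ∷ _) ∷ _) _ eq _ _ _ = ⊥-elim (x≢ (eq (here refl) (there (here refl))))
length-cong {ys = _ ∷ _ ∷ _} _ ((y≢ ∷ _) ∷ _) _ eq _ _ = ⊥-elim (y≢ (eq (here refl) (there (here refl))))

count-cong : ∀ (α : Comp n) {m m′} → (Occurs α m → Occurs α m′) → (Occurs α m′ → Occurs α m) →
             length (occurrences α m) ≡ length (occurrences α m′)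
count-cong α {m} {m′} f g = length-cong
  (occurrences-unique α m) (occurrences-unique α m′) (equal m) (equal m′) (transport f) (transport g)
  where
  equal : ∀ m {i j} → i ∈ occurrences α m → j ∈ occurrences α m → i ≡ j
  equal m i∈ j∈ with i↑ , i≈ ← occurrences-sound α m i∈ | j↑ , j≈ ← occurrences-sound α m j∈ =
    occurs-unique α {m} i↑ i≈ j↑ j≈

  transport : ∀ {m m′} → (Occurs α m → Occurs α m′) → ∀ {i} → i ∈ occurrences α m → ∃ (_∈ occurrences α m′)
  transport {m} {m′} f i∈ with i↑ , i≈ ← occurrences-sound α m i∈ with occurs j↑ j≈ ← f (occurs i↑ i≈) =
    _ , occurrences-complete α m′ j↑ j≈

occurs⇒parts : ∀ (α : Comp n) {i β : Vec ℕ p} → Increasing i → Occurs α (x[ i ]^ β) →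
               parts α ≡ map proj₂ (nonzeros (terms i β))
occurs⇒parts α {i} {β} i↑ (occurs {j} j↑ eq) = trans (sym (toList-fromList (parts α)))
  (trans (sym (terms-exponents j (vector α))) (cong (map proj₂) (value-injective
    (ascending j↑) (nonzeros-ascending (ascending i↑))
    (terms-positive (vector-positive α)) (nonzeros-positive (terms i β))
    (λ k → trans (sym (value-terms j _ k)) (trans (eq k)
      (trans (value-terms i β k) (sym (value-nonzeros (terms i β) k))))))))

parts⇒occurs : ∀ (α : Comp n) {i β : Vec ℕ p} → Increasing i →
               parts α ≡ map proj₂ (nonzeros (terms i β)) → Occurs α (x[ i ]^ β)
parts⇒occurs (composition _ _ _) {i} {β} i↑ refl = occurs
  {index = indices t}
  (increasing⁻ (subst (Ascending 0) (sym (terms-indices t)) (nonzeros-ascending (ascending i↑))))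
  (λ k → trans (value-terms (indices t) _ k) (trans (cong (λ t → value t k) (terms-indices t))
    (trans (value-nonzeros (terms i β) k) (sym (value-terms i β k)))))
  where t = nonzeros (terms i β)

count-shift : ∀ (α : Comp n) {i j β : Vec ℕ p} → Increasing i → Increasing j →
              length (occurrences α (x[ i ]^ β)) ≡ length (occurrences α (x[ j ]^ β))
count-shift α {i} {j} {β} i↑ j↑ = count-cong α {_} {_}
  (λ o → parts⇒occurs α j↑ (trans (occurs⇒parts α i↑ o) (nonzeros-exponents {i = i} {j} {β})))
  (λ o → parts⇒occurs α i↑ (trans (occurs⇒parts α j↑ o) (nonzeros-exponents {i = j} {i} {β})))

count-≈ : ∀ (α : Comp n) {m m′} → m ≈ₘ m′ → length (occurrences α m) ≡ length (occurrences α m′)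
count-≈ α m≈ = count-cong α {_} {_}
  (λ (occurs i↑ eq) → occurs i↑ (λ k → trans (eq k) (m≈ k)))
  (λ (occurs i↑ eq) → occurs i↑ (λ k → trans (eq k) (sym (m≈ k))))

initial-increasing : ∀ p → Increasing (initial p)
initial-increasing p = go toℕ (λ i<j → i<j)
  where
  go : ∀ {p} (f : Fin p → ℕ) → (∀ {i j} → toℕ i < toℕ j → f i < f j) → Increasing (Vec.tabulate f)
  go {zero}        f mono = []
  go {suc zero}    f mono = [-]
  go {suc (suc p)} f mono = mono (s≤s z≤n) ∷ go (f ∘ Fin.suc) (λ i<j → mono (s≤s i<j))

sum-powerExponent : ∀ i a b → sum (applyUpTo (powerExponent i a) b) ≤ a
sum-powerExponent i       a zero    = z≤n
sum-powerExponent zero    a (suc b) = ℕ.≤-reflexive (trans (cong (a ℕ.+_) (zeros b)) (ℕ.+-identityʳ a))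
  where
  zeros : ∀ b → sum (applyUpTo (λ _ → 0) b) ≡ 0
  zeros zero    = refl
  zeros (suc b) = zeros b
sum-powerExponent (suc i) a (suc b) = sum-powerExponent i a b

sum-applyUpTo-+ : ∀ f g b → sum (applyUpTo (λ k → f k ℕ.+ g k) b) ≡
                            sum (applyUpTo f b) ℕ.+ sum (applyUpTo g b)
sum-applyUpTo-+ f g zero    = refl
sum-applyUpTo-+ f g (suc b) = trans
  (cong (f 0 ℕ.+ g 0 ℕ.+_) (sum-applyUpTo-+ (f ∘ suc) (g ∘ suc) b))
  (CommutativeSemigroup.interchange ℕ.+-commutativeSemigroup (f 0) (g 0) _ _)

sum-applyUpTo-cong : ∀ {f g} → (∀ k → f k ≡ g k) → ∀ b → sum (applyUpTo f b) ≡ sum (applyUpTo g b)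
sum-applyUpTo-cong f≗g zero    = refl
sum-applyUpTo-cong f≗g (suc b) = cong₂ ℕ._+_ (f≗g 0) (sum-applyUpTo-cong (f≗g ∘ suc) b)

sum-exponents : ∀ (i α : Vec ℕ p) b → sum (applyUpTo (exponent (x[ i ]^ α)) b) ≤ sum (Vec.toList α)
sum-exponents []       []       zero    = z≤n
sum-exponents []       []       (suc b) = sum-exponents [] [] b
sum-exponents (i ∷ is) (a ∷ as) b       = ℕ.≤-trans
  (ℕ.≤-reflexive (sum-applyUpTo-+ (powerExponent i a) _ b))
  (ℕ.+-mono-≤ (sum-powerExponent i a b) (sum-exponents is as b))

occurs-degree : ∀ (α : Comp n) {m} → Occurs α m → degree m ≤ n
occurs-degree {n} α@(composition as _ s) {m} (occurs {i} _ eq) = begin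
  degree m                                                ≡⟨ sum-applyUpTo-cong eq (bound m) ⟨
  sum (applyUpTo (exponent (x[ i ]^ vector α)) (bound m)) ≤⟨ sum-exponents i (vector α) (bound m) ⟩
  sum (Vec.toList (vector α))                             ≡⟨ cong sum (toList-fromList as) ⟩
  sum as                                                  ≡⟨ recompute (_ ℕ.≟ _) s ⟩
  n                                                       ∎
  where open ℕ.≤-Reasoning

count-degree : ∀ (α : Comp n) m → n < degree m → length (occurrences α m) ≡ 0
count-degree α m n< with occurrences α m in eq
... | []    = refl
... | i ∷ _ with i↑ , i≈ ← occurrences-sound α m (subst (i ∈_) (sym eq) (here refl)) =
  ⊥-elim (ℕ.<⇒≱ n< (occurs-degree α {m} (occurs i↑ i≈)))

module _ {r ℓr m ℓm} {R : CommutativeRing r ℓr} (M : Module R m ℓm) where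
  open CommutativeRing R using (Carrier; _≈_; 0#)
  open Module M

  sumᴹ : List Carrierᴹ → Carrierᴹ
  sumᴹ = foldr _+ᴹ_ 0ᴹ

  module _ {i} {I : Set i} (b : I → Carrierᴹ) where

    combination : List (Carrier × I) → Carrierᴹ
    combination ts = sumᴹ (map (λ (c , i) → c *ₗ b i) ts)

    -- A linear combination is a list of (coefficient , index) pairs. Independence
    -- concerns those with pairwise distinct indices.

    LinearlyIndependent : Set _
    LinearlyIndependent = ∀ ts → Unique (map proj₂ ts) → combination ts ≈ᴹ 0ᴹ →
                          All (λ (c , _) → c ≈ 0#) ts

    Spanning : Set _
    Spanning = ∀ v → ∃ λ ts → combination ts ≈ᴹ v

    IsBasis : Set _
    IsBasis = LinearlyIndependent × Spanning

  record IsSubmodule {q} (P : Carrierᴹ → Set q) : Set (r ⊔ˡ m ⊔ˡ q) where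
    field
      +-closed : ∀ {u v} → P u → P v → P (u +ᴹ v)
      0-closed : P 0ᴹ
      *-closed : ∀ c {v} → P v → P (c *ₗ v)
      -‿closed : ∀ {v} → P v → P (-ᴹ v)

  submodule : ∀ {q} {P : Carrierᴹ → Set q} → IsSubmodule P → Module R (m ⊔ˡ q) ℓm
  submodule {q} {P} closed = record
    { isModule = ModuleMonomorphism.isModule isMonomorphism isCommutativeRing isModule }
    where
    open IsSubmodule closed
    open CommutativeRing R using (isCommutativeRing)

    raw : RawModule Carrier (m ⊔ˡ q) ℓm
    raw = record
      { Carrierᴹ = Σ Carrierᴹ P
      ; _≈ᴹ_     = λ u v → proj₁ u ≈ᴹ proj₁ v
      ; _+ᴹ_     = λ (u , pu) (v , pv) → u +ᴹ v , +-closed pu pv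
      ; _*ₗ_     = λ c (v , pv) → c *ₗ v , *-closed c pv
      ; _*ᵣ_     = λ (v , pv) c → c *ₗ v , *-closed c pv
      ; 0ᴹ       = 0ᴹ , 0-closed
      ; -ᴹ_      = λ (v , pv) → -ᴹ v , -‿closed pv
      }

    open ModuleMorphisms.ModuleMorphisms raw rawModule using (IsModuleMonomorphism)

    isMonomorphism : IsModuleMonomorphism proj₁
    isMonomorphism = record
      { isModuleHomomorphism = record
        { isBimoduleHomomorphism = record
          { +ᴹ-isGroupHomomorphism = record
            { isMonoidHomomorphism = record
              { isMagmaHomomorphism = record
                { isRelHomomorphism = record { cong = λ eq → eq }
                ; homo = λ _ _ → ≈ᴹ-refl
                }
              ; ε-homo = ≈ᴹ-refl
              }
            ; ⁻¹-homo = λ _ → ≈ᴹ-refl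
            }
          ; *ₗ-homo = λ _ _ → ≈ᴹ-refl
          ; *ᵣ-homo = λ c v → *ₗ-*ᵣ-coincident c (proj₁ v)
          }
        }
      ; injective = λ eq → eq
      }

module _ {c ℓ′} (k : CommutativeRing c ℓ′) where
  open CommutativeRing k renaming (refl to ≈-refl; sym to ≈-sym; trans to ≈-trans)
  open SemiringExp semiring using (_^_)
  open SemiringMult semiring using () renaming (_×_ to _×ℕ_)
  private
    module R = RingProperties ring

  record PowerSeries : Set (c ⊔ˡ ℓ′) where
    field
      coeff      : Monomial → Carrier
      coeff-cong : ∀ {m m′} → m ≈ₘ m′ → coeff m ≈ coeff m′

  open PowerSeries

  powerSeries : Module k (c ⊔ˡ ℓ′) ℓ′
  powerSeries = record
    { Carrierᴹ = PowerSeries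
    ; _≈ᴹ_     = λ f g → ∀ m → coeff f m ≈ coeff g m
    ; _+ᴹ_     = λ f g → record
      { coeff      = λ m → coeff f m + coeff g m
      ; coeff-cong = λ m≈ → +-cong (coeff-cong f m≈) (coeff-cong g m≈)
      }
    ; 0ᴹ       = record { coeff = λ _ → 0# ; coeff-cong = λ _ → ≈-refl }
    ; -ᴹ_      = λ f → record
      { coeff      = λ m → - coeff f m
      ; coeff-cong = λ m≈ → -‿cong (coeff-cong f m≈)
      }
    ; _*ₗ_     = λ a f → record
      { coeff      = λ m → a * coeff f m
      ; coeff-cong = λ m≈ → *-congˡ (coeff-cong f m≈)
      }
    ; isModule = Biased.IsModuleFromLeft.isModule (record
      { isLeftModule = record
        { isLeftSemimodule = record
          { +ᴹ-isCommutativeMonoid = record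
            { isMonoid = record
              { isSemigroup = record
                { isMagma = record
                  { isEquivalence = record
                    { refl  = λ m → ≈-refl
                    ; sym   = λ eq m → ≈-sym (eq m)
                    ; trans = λ eq eq′ m → ≈-trans (eq m) (eq′ m)
                    }
                  ; ∙-cong = λ eq eq′ m → +-cong (eq m) (eq′ m)
                  }
                ; assoc = λ f g h m → +-assoc _ _ _
                }
              ; identity = (λ f m → +-identityˡ _) , (λ f m → +-identityʳ _)
              }
            ; comm = λ f g m → +-comm _ _
            }
          ; isPreleftSemimodule = record
            { *ₗ-cong      = λ a≈ eq m → *-cong a≈ (eq m)
            ; *ₗ-zeroˡ     = λ f m → zeroˡ _
            ; *ₗ-distribʳ  = λ f a b m → distribʳ _ _ _
            ; *ₗ-identityˡ = λ f m → *-identityˡ _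
            ; *ₗ-assoc     = λ a b f m → *-assoc _ _ _
            ; *ₗ-zeroʳ     = λ a m → zeroʳ _
            ; *ₗ-distribˡ  = λ a f g m → distribˡ _ _ _
            }
          }
        ; -ᴹ‿cong    = λ eq m → -‿cong (eq m)
        ; -ᴹ‿inverse = (λ f m → -‿inverseˡ _) , (λ f m → -‿inverseʳ _)
        }
      })
    }

  -- k[[x₁, x₂, …]] and QSym are used only as k-modules, so their multiplication is
  -- not constructed.

  HasBoundedDegree : PowerSeries → Set ℓ′
  HasBoundedDegree f = ∃ λ d → ∀ m → d < degree m → coeff f m ≈ 0#

  IsShiftInvariant : PowerSeries → Set ℓ′
  IsShiftInvariant f = ∀ {p} (α i : Vec ℕ p) → Increasing i →
    coeff f (x[ initial p ]^ α) ≈ coeff f (x[ i ]^ α)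

  IsQuasisymmetric : PowerSeries → Set ℓ′
  IsQuasisymmetric f = HasBoundedDegree f × IsShiftInvariant f

  quasisymmetric-isSubmodule : IsSubmodule powerSeries IsQuasisymmetric
  quasisymmetric-isSubmodule = record
    { +-closed = λ ((d , f≈0) , f-shift) ((e , g≈0) , g-shift) →
        ( d ⊔ e , λ m d⊔e< → ≈-trans
          (+-cong (f≈0 m (ℕ.≤-<-trans (ℕ.m≤m⊔n d e) d⊔e<)) (g≈0 m (ℕ.≤-<-trans (ℕ.m≤n⊔m d e) d⊔e<)))
          (+-identityˡ 0#))
      , λ α i i↑ → +-cong (f-shift α i i↑) (g-shift α i i↑)
    ; 0-closed = (0 , λ _ _ → ≈-refl) , λ _ _ _ → ≈-refl
    ; *-closed = λ a ((d , f≈0) , f-shift) →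
        (d , λ m d< → ≈-trans (*-congˡ (f≈0 m d<)) (zeroʳ a))
      , λ α i i↑ → *-congˡ (f-shift α i i↑)
    ; -‿closed = λ ((d , f≈0) , f-shift) →
        (d , λ m d< → ≈-trans (-‿cong (f≈0 m d<)) R.-0#≈0#)
      , λ α i i↑ → -‿cong (f-shift α i i↑)
    }

  QSym : Module k (c ⊔ˡ ℓ′) ℓ′
  QSym = submodule powerSeries quasisymmetric-isSubmodule

  open Module QSym using (Carrierᴹ; _*ₗ_)

  -- The formal sum of all x_{i₁}^{α₁} ⋯ x_{iₚ}^{αₚ} with i₁ < ⋯ < iₚ: the coefficient
  -- of m counts the summands equal to m.

  monomialSeries : Comp n → PowerSeries
  monomialSeries α = record
    { coeff      = λ m → length (occurrences α m) ×ℕ 1#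
    ; coeff-cong = λ m≈ → reflexive (cong (_×ℕ 1#) (count-≈ α m≈))
    }

  M : Comp n → Carrierᴹ
  M {n} α = monomialSeries α
    , (n , λ m n< → reflexive (cong (_×ℕ 1#) (count-degree α m n<)))
    , λ β i i↑ → reflexive (cong (_×ℕ 1#) (count-shift α {β = β} (initial-increasing _) i↑))

  η : Comp n → Carrierᴹ
  η {n} α = sumᴹ QSym
    (map (λ β → (1# + 1#) ^ ℓ β *ₗ M β) (filter (λ β → Des β ⊆? Des α) (compositions n)))

{-# OPTIONS --safe #-}

-- The functional "coefficient of x₁^γ₁ ⋯ xₚ^γₚ" is dual to M_γ. Since Des β ⊆ Des α
-- forces ℓ β < ℓ α or β = α, the matrix of the η's in the M's is triangular with respect
-- to length, and its diagonal entries 2^ℓ(α) are invertible.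

module Submission where

open import Defs
open import Algebra.Bundles using (CommutativeMonoid; CommutativeRing)
open import Algebra.Definitions using (Invertible)
open import Algebra.Module.Bundles using (Module)
import Algebra.Properties.CommutativeSemigroup as CommutativeSemigroup
import Algebra.Properties.CommutativeSemiring.Exp as Exp
import Algebra.Properties.Group as Group
import Algebra.Properties.Monoid.Mult as Mult
import Algebra.Properties.Semiring.Exp as SemiringExp
open import Data.Empty using (⊥-elim)
open import Data.Fin.Base as Fin using ()
open import Data.List.Base
  using (List; []; _∷_; _++_; applyUpTo; filter; length; map; take; upTo)
open import Data.List.Extrema.Nat using (max; xs≤max)
open import Data.List.Membership.Propositional using (_∈_)
open import Data.List.Membership.Propositional.Properties
  using (∈-filter⁺; ∈-filter⁻; ∈-map⁺; ∈-upTo⁺; ∈-upTo⁻)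
open import Data.List.Properties
  using (∷-injectiveˡ; ∷-injectiveʳ; length-applyUpTo; map-applyUpTo; map-injective; map-upTo)
open import Data.List.Relation.Unary.All as All using (All; []; _∷_)
import Data.List.Relation.Unary.All.Properties as All
open import Data.List.Relation.Unary.AllPairs as AllPairs using (AllPairs; []; _∷_)
import Data.List.Relation.Unary.AllPairs.Properties as AllPairs
open import Data.List.Relation.Unary.Any using (here; there)
import Data.List.Relation.Unary.Unique.Propositional.Properties as Unique
open import Data.Nat.Base as ℕ using (ℕ; zero; suc; NonZero; _≤_; _<_; z≤n; s≤s)
open import Data.Nat.ListAction using (sum)
import Data.Nat.Properties as ℕ
open import Data.Product.Base using (∃; _×_; _,_; proj₁; proj₂)
open import Data.Vec.Base as Vec using (Vec; []; _∷_)
import Data.Vec.Properties as Vec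
open import Function.Base using (_∘_; id; _on_)
open import Level using () renaming (_⊔_ to _⊔ˡ_)
open import Relation.Binary.PropositionalEquality
  using (_≡_; _≢_; refl; sym; trans; cong; cong₂; subst; subst₂)
import Relation.Binary.Reasoning.Setoid as SetoidReasoning
open import Relation.Nullary using (yes; no; contradiction)
open import Relation.Nullary.Decidable using (recompute)

private
  variable
    n p : ℕ

-- Descent sets and the compositions they determine

Ascendingᴸ : List ℕ → Set
Ascendingᴸ = AllPairs _<_

⊆-∷⁻ : ∀ {y xs ys} → All (y <_) xs → xs ⊆ y ∷ ys → xs ⊆ ys
⊆-∷⁻ y<xs xs⊆ x∈ with xs⊆ x∈
... | here refl = contradiction (All.lookup y<xs x∈) (ℕ.<-irrefl refl)
... | there x∈ys = x∈ys

⊆∧length≤⇒≡ : ∀ {xs ys} → Ascendingᴸ xs → Ascendingᴸ ys → xs ⊆ ys → length ys ≤ length xs → xs ≡ ys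
⊆∧length≤⇒≡ {[]}     {[]}     _ _ _ _ = refl
⊆∧length≤⇒≡ {x ∷ xs} {[]}     _ _ xs⊆ _ with () ← xs⊆ (here refl)
⊆∧length≤⇒≡ {x ∷ xs} {y ∷ ys} (x<xs ∷ xs↑) (y<ys ∷ ys↑) xs⊆ (s≤s ys≤) with xs⊆ (here refl)
... | here refl =
  cong (x ∷_) (⊆∧length≤⇒≡ xs↑ ys↑ (⊆-∷⁻ x<xs (xs⊆ ∘ there)) ys≤)
... | there x∈ys = contradiction
  (cong length (⊆∧length≤⇒≡ (x<xs ∷ xs↑) ys↑ (⊆-∷⁻ (y<x ∷ All.map (ℕ.<-trans y<x) x<xs) xs⊆)
    (ℕ.m≤n⇒m≤1+n ys≤)))
  (ℕ.>⇒≢ (s≤s ys≤))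
  where y<x = All.lookup y<ys x∈ys

-- A recursive form of `Des` on plain lists, so that its properties follow by induction on the
-- parts.
descents : List ℕ → List ℕ
descents []           = []
descents (a ∷ [])     = []
descents (a ∷ b ∷ as) = a ∷ map (a ℕ.+_) (descents (b ∷ as))

partialSums≡descents : ∀ as →
  applyUpTo (λ k → sum (take (suc k) as)) (length as ℕ.∸ 1) ≡ descents as
partialSums≡descents []           = refl
partialSums≡descents (a ∷ [])     = refl
partialSums≡descents (a ∷ b ∷ as) = cong₂ _∷_ (ℕ.+-identityʳ a) (trans
  (sym (map-applyUpTo (λ k → sum (take (suc k) (b ∷ as))) (a ℕ.+_) (length as)))
  (cong (map (a ℕ.+_)) (partialSums≡descents (b ∷ as))))

Des≡descents : (α : Comp n) → Des α ≡ descents (parts α)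
Des≡descents α = trans (map-upTo _ _) (partialSums≡descents (parts α))

length-Des : (α : Comp n) → length (Des α) ≡ ℓ α ℕ.∸ 1
length-Des α = trans
  (cong length (map-upTo (λ k → sum (take (suc k) (parts α))) (ℓ α ℕ.∸ 1)))
  (length-applyUpTo _ (ℓ α ℕ.∸ 1))

descents-positive : ∀ {as} → All NonZero as → All (0 <_) (descents as)
descents-positive []            = []
descents-positive (_ ∷ [])      = []
descents-positive {a ∷ _} (a≢0 ∷ as@(_ ∷ _)) =
  0<a ∷ All.map⁺ (All.map (λ _ → ℕ.<-≤-trans 0<a (ℕ.m≤m+n a _)) (descents-positive as))
  where 0<a = ℕ.>-nonZero⁻¹ a {{a≢0}}

descents-ascending : ∀ {as} → All NonZero as → Ascendingᴸ (descents as)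
descents-ascending []       = []
descents-ascending (_ ∷ []) = []
descents-ascending {a ∷ _} (_ ∷ as@(_ ∷ _)) =
  All.map⁺ (All.map (ℕ.m<m+n a) (descents-positive as)) ∷
  AllPairs.map⁺ (AllPairs.map (ℕ.+-monoʳ-< a) (descents-ascending as))

-- The first descent is the first part, and subtracting it leaves the descents of the rest. Descents
-- stop short of the total, so the equation between the sums is what fixes the last part.
descents-injective : ∀ {as bs} → All NonZero as → All NonZero bs →
                     sum as ≡ sum bs → descents as ≡ descents bs → as ≡ bs
descents-injective []          []          _ _ = refl
descents-injective []          (_∷_ {b} b≢0 _) s _ =
  ⊥-elim (ℕ.≢-nonZero⁻¹ b {{b≢0}} (ℕ.m+n≡0⇒m≡0 b (sym s)))
descents-injective (_∷_ {a} a≢0 _) []          s _ =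
  ⊥-elim (ℕ.≢-nonZero⁻¹ a {{a≢0}} (ℕ.m+n≡0⇒m≡0 a s))
descents-injective {a ∷ []} {b ∷ []} (_ ∷ []) (_ ∷ []) s _ =
  cong (_∷ []) (trans (sym (ℕ.+-identityʳ a)) (trans s (ℕ.+-identityʳ b)))
descents-injective {a ∷ _} {b ∷ _} (_ ∷ as@(_ ∷ _)) (_ ∷ bs@(_ ∷ _)) s d = cong₂ _∷_ a≡b
  (descents-injective as bs
    (ℕ.+-cancelˡ-≡ a _ _ (trans s (cong (ℕ._+ _) (sym a≡b))))
    (map-injective (ℕ.+-cancelˡ-≡ a _ _)
      (trans (∷-injectiveʳ d) (cong (λ c → map (c ℕ.+_) _) (sym a≡b)))))
  where a≡b = ∷-injectiveˡ d

parts-sum : (α : Comp n) → sum (parts α) ≡ n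
parts-sum (composition _ _ s) = recompute (_ ℕ.≟ _) s

parts-injective : {α β : Comp n} → parts α ≡ parts β → α ≡ β
parts-injective {α = composition _ _ _} {composition _ _ _} refl = refl

Des-ascending : (α : Comp n) → Ascendingᴸ (Des α)
Des-ascending α = subst Ascendingᴸ (sym (Des≡descents α)) (descents-ascending (parts-positive α))

-- A composition has one descent fewer than parts (none if it is empty), so the length bound turns
-- the inclusion into an equality of descent sets, and these determine the composition.
-- Contrapositively, any other `β` with `Des β ⊆ Des α` is strictly shorter than `α`.
coarsest : (α β : Comp n) → Des β ⊆ Des α → ℓ α ≤ ℓ β → β ≡ α
coarsest α β β⊆α ℓα≤ℓβ = parts-injective (descents-injective
  (parts-positive β) (parts-positive α) (trans (parts-sum β) (sym (parts-sum α)))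
  (trans (sym (Des≡descents β)) (trans Desβ≡Desα (Des≡descents α))))
  where
  Desβ≡Desα = ⊆∧length≤⇒≡ (Des-ascending β) (Des-ascending α) β⊆α
    (subst₂ _≤_ (sym (length-Des α)) (sym (length-Des β)) (ℕ.∸-monoˡ-≤ 1 ℓα≤ℓβ))

-- Coefficients of monomial quasisymmetric functions at words

nonzeros-id : ∀ {t} → Positive t → nonzeros t ≡ t
nonzeros-id []                           = refl
nonzeros-id (_∷_ {_ , suc a} _ positive) = cong (_ ∷_) (nonzeros-id positive)

word : Comp n → Monomial
word α = x[ initial (ℓ α) ]^ vector α

-- An occurrence of `α` is read off from the nonzero exponents in the order of the variables, and
-- `word γ` has no zero exponents to delete. The sizes `n` and `p` may differ, hence the comparison
-- of parts.
occurs-word⇒parts : (α : Comp n) (γ : Comp p) → Occurs α (word γ) → parts α ≡ parts γ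
occurs-word⇒parts α γ o = trans (occurs⇒parts α (initial-increasing (ℓ γ)) o)
  (trans (cong (map proj₂) (nonzeros-id (terms-positive (vector-positive γ))))
    (trans (terms-exponents (initial (ℓ γ)) (vector γ)) (toList-fromList (parts γ))))

count-word-≢ : (α : Comp n) (γ : Comp p) → parts α ≢ parts γ →
               length (occurrences α (word γ)) ≡ 0
count-word-≢ α γ α≢γ with occurrences α (word γ) in eq
... | []    = refl
... | i ∷ _ with i↑ , i≈ ← occurrences-sound α (word γ) (subst (i ∈_) (sym eq) (here refl)) =
  contradiction (occurs-word⇒parts α γ (occurs i↑ i≈)) α≢γ

count-word-≡ : (α : Comp n) → length (occurrences α (word α)) ≡ 1
count-word-≡ α = length-cong {ys = initial (ℓ α) ∷ []} (occurrences-unique α (word α)) ([] ∷ [])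
  equal (λ { (here refl) (here refl) → refl })
  (λ _ → _ , here refl)
  (λ _ → _ , occurrences-complete α (word α) (initial-increasing (ℓ α)) (λ _ → refl))
  where
  equal : ∀ {i j} → i ∈ occurrences α (word α) → j ∈ occurrences α (word α) → i ≡ j
  equal i∈ j∈ with i↑ , i≈ ← occurrences-sound α _ i∈ | j↑ , j≈ ← occurrences-sound α _ j∈ =
    occurs-unique α {word α} i↑ i≈ j↑ j≈

-- Reading a composition off an arbitrary monomial

sum-nonzeros : (i α : Vec ℕ p) → sum (map proj₂ (nonzeros (terms i α))) ≡ sum (Vec.toList α)
sum-nonzeros []       []           = refl
sum-nonzeros (_ ∷ is) (zero ∷ as)  = sum-nonzeros is as
sum-nonzeros (_ ∷ is) (suc a ∷ as) = cong (suc a ℕ.+_) (sum-nonzeros is as)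

value-shift-zero : (i α : Vec ℕ p) → value (terms (Vec.map suc i) α) 0 ≡ 0
value-shift-zero []       []       = refl
value-shift-zero (_ ∷ is) (_ ∷ as) = value-shift-zero is as

value-shift-suc : ∀ (i α : Vec ℕ p) k → value (terms (Vec.map suc i) α) (suc k) ≡ value (terms i α) k
value-shift-suc []       []       k = refl
value-shift-suc (i ∷ is) (a ∷ as) k = cong (powerExponent i a k ℕ.+_) (value-shift-suc is as k)

value-initial : ∀ (e : ℕ → ℕ) b → (∀ k → b ≤ k → e k ≡ 0) → let as = applyUpTo e b in
                ∀ k → value (terms (initial (length as)) (Vec.fromList as)) k ≡ e k
value-initial e zero    e≡0 k = sym (e≡0 k z≤n)
value-initial e (suc b) e≡0 k
  -- The tail of `initial` tabulates `suc ∘ toℕ`; rewritten as a shift of a shorter `initial`, it is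
  -- accessible to the recursion.
  rewrite Vec.tabulate-∘ suc (Fin.toℕ {length (applyUpTo (e ∘ suc) b)}) = go k
  where
  as = applyUpTo (e ∘ suc) b

  go : ∀ k → value ((0 , e 0) ∷ terms (Vec.map suc (initial (length as))) (Vec.fromList as)) k ≡ e k
  go zero    = trans (cong (e 0 ℕ.+_) (value-shift-zero (initial (length as)) _)) (ℕ.+-identityʳ (e 0))
  go (suc k) = trans (value-shift-suc (initial (length as)) _ k)
    (value-initial (e ∘ suc) b (λ k b≤k → e≡0 (suc k) (s≤s b≤k)) k)

module _ (m : Monomial) where

  exponents : List ℕ
  exponents = applyUpTo (exponent m) (bound m)

  -- Presents `m` as a product over all variables below its bound, zero exponents included, which is
  -- the form that `parts⇒occurs` works with.
  spread : Monomial
  spread = x[ initial (length exponents) ]^ Vec.fromList exponents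

  spread-≈ : spread ≈ₘ m
  spread-≈ k = trans (value-terms (initial (length exponents)) _ k)
    (value-initial (exponent m) (bound m) (finite m) k)

  content : Comp (degree m)
  content = composition (map proj₂ (nonzeros t)) (All.map⁺ (nonzeros-positive t))
    (trans (sum-nonzeros (initial (length exponents)) _) (cong sum (toList-fromList exponents)))
    where t = terms (initial (length exponents)) (Vec.fromList exponents)

  content-occurs : Occurs content spread
  content-occurs = parts⇒occurs content (initial-increasing (length exponents)) refl

-- No exponents are added up: `content (word γ)` is by its type a composition of this degree, and
-- since it occurs in `word γ` it has the parts of `γ`.
degree-word : (γ : Comp n) → degree (word γ) ≡ n
degree-word γ with occurs j↑ j≈ ← content-occurs (word γ) =
  trans (sym (parts-sum (content (word γ)))) (trans
    (cong sum (occurs-word⇒parts (content (word γ)) γ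
      (occurs j↑ (λ k → trans (j≈ k) (spread-≈ (word γ) k)))))
    (parts-sum γ))

-- Sums, submodules and spans in a module

module _ {r ℓr m ℓm} {R : CommutativeRing r ℓr} (N : Module R m ℓm) where
  open CommutativeRing R using (Carrier; _≈_; _+_; _*_; -_; 0#; 1#; -‿inverseˡ)
  open Module N
  open Group +ᴹ-group using (inverseˡ-unique; //-rightDividesʳ)

  module _ {q} {P : Carrierᴹ → Set q} (closed : IsSubmodule N P) where
    open IsSubmodule closed

    module _ {a} {A : Set a} (f : A → Carrierᴹ) where

      sum-closed : ∀ xs → (∀ {x} → x ∈ xs → P (f x)) → P (sumᴹ N (map f xs))
      sum-closed []       Pf = 0-closed
      sum-closed (_ ∷ xs) Pf = +-closed (Pf (here refl)) (sum-closed xs (Pf ∘ there))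

      -- Isolates one summand modulo `P`. Taking `P` to be the kernel of a coordinate evaluates that
      -- coordinate on a sum; taking it to be a span solves for one generator. The key `g` is `id`
      -- for lists without repetition and the index projection for linear combinations.
      sum-extract : ∀ {b} {B : Set b} (g : A → B) {x xs} → x ∈ xs → AllPairs (_≢_ on g) xs →
        (∀ {y} → y ∈ xs → g y ≢ g x → P (f y)) →
        ∃ λ v → P v × sumᴹ N (map f xs) ≈ᴹ f x +ᴹ v
      sum-extract g {xs = x ∷ xs} (here refl) (x≢ ∷ _) Pf =
        sumᴹ N (map f xs) ,
        sum-closed xs (λ y∈ → Pf (there y∈) (All.lookup x≢ y∈ ∘ sym)) ,
        ≈ᴹ-refl
      sum-extract g {x} {z ∷ xs} (there x∈) (z≢ ∷ distinct) Pf
        with v , Pv , eq ← sum-extract g x∈ distinct (Pf ∘ there) =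
        f z +ᴹ v ,
        +-closed (Pf (here refl) (All.lookup z≢ x∈)) Pv ,
        ≈ᴹ-trans (+ᴹ-congˡ eq) (x∙yz≈y∙xz (f z) (f x) v)
        where
        open CommutativeSemigroup
          (CommutativeMonoid.commutativeSemigroup +ᴹ-commutativeMonoid) using (x∙yz≈y∙xz)

  -1*ₗ : ∀ v → (- 1#) *ₗ v ≈ᴹ -ᴹ v
  -1*ₗ v = inverseˡ-unique _ _ (begin
    (- 1#) *ₗ v +ᴹ v            ≈⟨ +ᴹ-congˡ (*ₗ-identityˡ v) ⟨
    (- 1#) *ₗ v +ᴹ 1# *ₗ v      ≈⟨ *ₗ-distribʳ v (- 1#) 1# ⟨
    (- 1# + 1#) *ₗ v            ≈⟨ *ₗ-congʳ (-‿inverseˡ 1#) ⟩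
    0# *ₗ v                     ≈⟨ *ₗ-zeroˡ v ⟩
    0ᴹ                          ∎)
    where
    open SetoidReasoning ≈ᴹ-setoid

  module _ {i} {I : Set i} (b : I → Carrierᴹ) where

    InSpan : Carrierᴹ → Set _
    InSpan v = ∃ λ ts → combination N b ts ≈ᴹ v

    InSpan-resp-≈ : ∀ {u v} → u ≈ᴹ v → InSpan u → InSpan v
    InSpan-resp-≈ u≈v (ts , eq) = ts , ≈ᴹ-trans eq u≈v

    combination-++ : ∀ ts us → combination N b (ts ++ us) ≈ᴹ combination N b ts +ᴹ combination N b us
    combination-++ []       us = ≈ᴹ-sym (+ᴹ-identityˡ _)
    combination-++ (t ∷ ts) us = ≈ᴹ-trans (+ᴹ-congˡ (combination-++ ts us)) (≈ᴹ-sym (+ᴹ-assoc _ _ _))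

    combination-*ₗ : ∀ c ts → combination N b (map (λ (a , i) → c * a , i) ts) ≈ᴹ c *ₗ combination N b ts
    combination-*ₗ c []       = ≈ᴹ-sym (*ₗ-zeroʳ c)
    combination-*ₗ c (t ∷ ts) = ≈ᴹ-trans
      (+ᴹ-cong (*ₗ-assoc _ _ _) (combination-*ₗ c ts)) (≈ᴹ-sym (*ₗ-distribˡ c _ _))

    *ₗ-inSpan : ∀ c {v} → InSpan v → InSpan (c *ₗ v)
    *ₗ-inSpan c (ts , eq) = map (λ (a , i) → c * a , i) ts , 
      ≈ᴹ-trans (combination-*ₗ c ts) (*ₗ-congˡ eq)

    span-isSubmodule : IsSubmodule N InSpan
    span-isSubmodule = record
      { +-closed = λ (ts , eq) (us , eq′) →
          ts ++ us , ≈ᴹ-trans (combination-++ ts us) (+ᴹ-cong eq eq′)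
      ; 0-closed = [] , ≈ᴹ-refl
      ; *-closed = *ₗ-inSpan
      ; -‿closed = λ {v} s → InSpan-resp-≈ (-1*ₗ v) (*ₗ-inSpan (- 1#) s)
      }

    generator-inSpan : ∀ i → InSpan (b i)
    generator-inSpan i = (1# , i) ∷ [] , ≈ᴹ-trans (+ᴹ-identityʳ _) (*ₗ-identityˡ _)

    inSpan-cancel-+ : ∀ {u v w} → w ≈ᴹ u +ᴹ v → InSpan w → InSpan v → InSpan u
    inSpan-cancel-+ {u} {v} w≈u+v w∈ v∈ = InSpan-resp-≈
      (≈ᴹ-trans (+ᴹ-congʳ w≈u+v) (//-rightDividesʳ v u)) (+-closed w∈ (-‿closed v∈))
      where open IsSubmodule span-isSubmodule

    inSpan-cancel-*ₗ : ∀ {c d v} → d * c ≈ 1# → InSpan (c *ₗ v) → InSpan v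
    inSpan-cancel-*ₗ {c} {d} {v} dc≈1 v∈ = InSpan-resp-≈
      (≈ᴹ-trans (≈ᴹ-sym (*ₗ-assoc d c v)) (≈ᴹ-trans (*ₗ-congʳ dc≈1) (*ₗ-identityˡ v)))
      (*ₗ-inSpan d v∈)

-- Compositions as indices

index-≡ : {α : Comp n} {β : Comp p} → parts α ≡ parts β →
          _≡_ {A = ∃ Comp} (n , α) (p , β)
index-≡ {α = α} {β = β} eq
  -- Equal parts have equal sums, so the sizes `n` and `p` coincide as well.
  with refl ← trans (sym (parts-sum α)) (trans (cong sum eq) (parts-sum β)) =
  cong (_ ,_) (parts-injective eq)

-- In the usual order these are the coarsenings of `α`, the compositions that `α` refines. The list
-- is literally the one summed over in `η`.
refinements : Comp n → List (Comp n)
refinements {n} α = filter (λ β → Des β ⊆? Des α) (compositions n)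

refinements-unique : (α : Comp n) → AllPairs _≢_ (refinements α)
refinements-unique α = Unique.filter⁺ _ (compositions-unique _)

refinements-refl : (α : Comp n) → α ∈ refinements α
refinements-refl α = ∈-filter⁺ (λ β → Des β ⊆? Des α) (compositions-complete α) id

refinements-⊆ : ∀ (α : Comp n) {β} → β ∈ refinements α → Des β ⊆ Des α
refinements-⊆ {n} α β∈ = proj₂ (∈-filter⁻ (λ β → Des β ⊆? Des α) {xs = compositions n} β∈)


-- What the argument uses of QSym and the family M_α; there, coordinate γ is the
-- coefficient of x₁^γ₁ ⋯ xₚ^γₚ.

record IsCoordinateSystem {r ℓr m ℓm} {R : CommutativeRing r ℓr} (N : Module R m ℓm)
  (e : ∀ {n} → Comp n → Module.Carrierᴹ N)
  (coordinate : ∀ {n} → Comp n → Module.Carrierᴹ N → CommutativeRing.Carrier R) :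
  Set (r ⊔ˡ ℓr ⊔ˡ m ⊔ˡ ℓm) where
  open CommutativeRing R using (_≈_; _+_; _*_; 0#; 1#)
  open Module N
  field
    coordinate-cong : ∀ (γ : Comp n) {u v} → u ≈ᴹ v → coordinate γ u ≈ coordinate γ v
    coordinate-+    : ∀ (γ : Comp n) u v → coordinate γ (u +ᴹ v) ≈ coordinate γ u + coordinate γ v
    coordinate-*ₗ   : ∀ (γ : Comp n) a v → coordinate γ (a *ₗ v) ≈ a * coordinate γ v
    coordinate-≡    : ∀ (α : Comp n) → coordinate α (e α) ≈ 1#
    coordinate-≢    : ∀ (α : Comp n) (γ : Comp p) → parts α ≢ parts γ → coordinate γ (e α) ≈ 0#
    bounded         : ∀ v → ∃ λ d → ∀ {n} (γ : Comp n) → d < n → coordinate γ v ≈ 0#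
    separating      : ∀ {u v} → (∀ {n} (γ : Comp n) → coordinate γ u ≈ coordinate γ v) → u ≈ᴹ v

-- Triangularity and expansion in a coordinate system

module _ {r ℓr m ℓm} {R : CommutativeRing r ℓr} (N : Module R m ℓm)
  {e : ∀ {n} → Comp n → Module.Carrierᴹ N}
  {coordinate : ∀ {n} → Comp n → Module.Carrierᴹ N → CommutativeRing.Carrier R}
  (system : IsCoordinateSystem N e coordinate) where
  open CommutativeRing R renaming (refl to ≈-refl; sym to ≈-sym; trans to ≈-trans)
  open SemiringExp semiring using (_^_; ^-congˡ)
  open Module N
  open IsCoordinateSystem system

  private
    2# : Carrier
    2# = 1# + 1#

  -- As a submodule, the vanishing of a coordinate falls under `sum-closed` and `sum-extract`. Zero
  -- and negatives are handled as multiples by `0#` and `- 1#`, since only sums and multiples are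
  -- covered by the axioms.
  kernel : (γ : Comp n) → IsSubmodule N (λ v → coordinate γ v ≈ 0#)
  kernel γ = record
    { +-closed = λ {u} {v} u≈0 v≈0 → ≈-trans (coordinate-+ γ u v)
        (≈-trans (+-cong u≈0 v≈0) (+-identityˡ 0#))
    ; 0-closed = ≈-trans (coordinate-cong γ (≈ᴹ-sym (*ₗ-zeroˡ 0ᴹ)))
        (≈-trans (coordinate-*ₗ γ 0# 0ᴹ) (zeroˡ _))
    ; *-closed = *-closed
    ; -‿closed = λ {v} v≈0 → ≈-trans (coordinate-cong γ (≈ᴹ-sym (-1*ₗ N v))) (*-closed (- 1#) v≈0)
    }
    where
    *-closed : ∀ a {v} → coordinate γ v ≈ 0# → coordinate γ (a *ₗ v) ≈ 0#
    *-closed a {v} v≈0 = ≈-trans (coordinate-*ₗ γ a v) (≈-trans (*-congˡ v≈0) (zeroʳ a))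

  coordinate-extract : ∀ (γ : Comp n) {a b} {A : Set a} {B : Set b} (f : A → Carrierᴹ) (g : A → B)
    {x xs} → x ∈ xs → AllPairs (_≢_ on g) xs →
    (∀ {y} → y ∈ xs → g y ≢ g x → coordinate γ (f y) ≈ 0#) →
    coordinate γ (sumᴹ N (map f xs)) ≈ coordinate γ (f x)
  coordinate-extract γ f g {x} {xs} x∈ distinct others
    with v , v≈0 , eq ← sum-extract N (kernel γ) f g x∈ distinct others = begin
    coordinate γ (sumᴹ N (map f xs))    ≈⟨ coordinate-cong γ eq ⟩
    coordinate γ (f x +ᴹ v)             ≈⟨ coordinate-+ γ (f x) v ⟩
    coordinate γ (f x) + coordinate γ v ≈⟨ +-congˡ v≈0 ⟩
    coordinate γ (f x) + 0#             ≈⟨ +-identityʳ _ ⟩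
    coordinate γ (f x)                  ∎
    where open SetoidReasoning setoid

  coordinate-multiple-≡ : ∀ a (α : Comp n) → coordinate α (a *ₗ e α) ≈ a
  coordinate-multiple-≡ a α = ≈-trans (coordinate-*ₗ α a (e α))
    (≈-trans (*-congˡ (coordinate-≡ α)) (*-identityʳ a))

  coordinate-multiple-≢ : ∀ a (α : Comp n) (γ : Comp p) → parts α ≢ parts γ →
                          coordinate γ (a *ₗ e α) ≈ 0#
  coordinate-multiple-≢ a α γ α≢γ = IsSubmodule.*-closed (kernel γ) a (coordinate-≢ α γ α≢γ)

  summand : Comp n → Carrierᴹ
  summand β = 2# ^ ℓ β *ₗ e β

  enriched : Comp n → Carrierᴹ
  enriched α = sumᴹ N (map summand (refinements α))

  coordinate-enriched-≡ : (α : Comp n) → coordinate α (enriched α) ≈ 2# ^ ℓ α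
  coordinate-enriched-≡ α = ≈-trans
    (coordinate-extract α summand id (refinements-refl α) (refinements-unique α)
      (λ {β} _ β≢α → coordinate-multiple-≢ (2# ^ ℓ β) β α (β≢α ∘ parts-injective)))
    (coordinate-multiple-≡ (2# ^ ℓ α) α)

  -- A summand at `β` could contribute only if `β` has the parts of `γ`. It would then be at least
  -- as long as `α`, hence equal to `α` by `coarsest`, against `α≢γ`.
  coordinate-enriched-≢ : ∀ (α : Comp n) (γ : Comp p) → parts α ≢ parts γ → ℓ α ≤ ℓ γ →
                          coordinate γ (enriched α) ≈ 0#
  coordinate-enriched-≢ α γ α≢γ ℓα≤ℓγ = sum-closed N (kernel γ) summand (refinements α)
    (λ {β} β∈ → coordinate-multiple-≢ (2# ^ ℓ β) β γ (λ β≡γ → α≢γ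
      (trans (cong parts (sym (coarsest α β (refinements-⊆ α β∈)
        (ℕ.≤-trans ℓα≤ℓγ (ℕ.≤-reflexive (cong length (sym β≡γ))))))) β≡γ)))

  -- In `QSym` this is the homogeneous component of `v` of degree `n`.
  component : Carrierᴹ → ℕ → Carrierᴹ
  component v n = sumᴹ N (map (λ α → coordinate α v *ₗ e α) (compositions n))

  coordinate-component-≡ : ∀ v (γ : Comp n) → coordinate γ (component v n) ≈ coordinate γ v
  coordinate-component-≡ v γ = ≈-trans
    (coordinate-extract γ (λ α → coordinate α v *ₗ e α) id
      (compositions-complete γ) (compositions-unique _)
      (λ {α} _ α≢γ → coordinate-multiple-≢ (coordinate α v) α γ (α≢γ ∘ parts-injective)))
    (coordinate-multiple-≡ (coordinate γ v) γ)

  coordinate-component-≢ : ∀ v {p} (γ : Comp n) → p ≢ n → coordinate γ (component v p) ≈ 0#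
  coordinate-component-≢ v γ p≢n = sum-closed N (kernel γ) (λ α → coordinate α v *ₗ e α) (compositions _)
    (λ {α} _ → coordinate-multiple-≢ (coordinate α v) α γ (p≢n ∘ cong proj₁ ∘ index-≡ {α = α} {β = γ}))

  -- By `separating` it suffices to compare coordinates. At a composition of `n` only the component
  -- of degree `n` contributes, and beyond the bound `d` both sides vanish. Degree `d` itself may
  -- occur, while `upTo` excludes its end, hence `suc d`.
  expansion : ∀ v → let d = proj₁ (bounded v) in sumᴹ N (map (component v) (upTo (suc d))) ≈ᴹ v
  expansion v with d , v≈0 ← bounded v = separating coordinates
    where
    coordinates : ∀ {n} (γ : Comp n) →
      coordinate γ (sumᴹ N (map (component v) (upTo (suc d)))) ≈ coordinate γ v
    coordinates {n} γ with n ℕ.≤? d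
    ... | yes n≤d = ≈-trans
      (coordinate-extract γ (component v) id (∈-upTo⁺ (s≤s n≤d)) (Unique.upTo⁺ (suc d))
        (λ {p} _ → coordinate-component-≢ v {p} γ))
      (coordinate-component-≡ v γ)
    ... | no n≰d = ≈-trans
      (sum-closed N (kernel γ) (component v) (upTo (suc d)) (λ {p} p∈ → coordinate-component-≢ v {p} γ
        (λ { refl → n≰d (ℕ.s≤s⁻¹ (∈-upTo⁻ p∈)) })))
      (≈-sym (v≈0 γ (ℕ.≰⇒> n≰d)))

  -- Independence and spanning once 2 is inverted

  module _ {2⁻¹ : Carrier} (2⁻¹*2≈1 : 2⁻¹ * 2# ≈ 1#) where

    2⁻ⁿ*2ⁿ≈1 : ∀ n → 2⁻¹ ^ n * 2# ^ n ≈ 1#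
    2⁻ⁿ*2ⁿ≈1 n = ≈-trans (≈-sym (Exp.^-distrib-* commutativeSemiring 2⁻¹ 2# n))
      (≈-trans (^-congˡ n 2⁻¹*2≈1) (1^n≈1 n))
      where
      1^n≈1 : ∀ n → 1# ^ n ≈ 1#
      1^n≈1 zero    = ≈-refl
      1^n≈1 (suc n) = ≈-trans (*-identityˡ _) (1^n≈1 n)

    *2ⁿ-cancel : ∀ a n → a * 2# ^ n ≈ 0# → a ≈ 0#
    *2ⁿ-cancel a n a2ⁿ≈0 = begin
      a                      ≈⟨ *-identityʳ a ⟨
      a * 1#                 ≈⟨ *-congˡ (≈-trans (*-comm _ _) (2⁻ⁿ*2ⁿ≈1 n)) ⟨
      a * (2# ^ n * 2⁻¹ ^ n) ≈⟨ *-assoc _ _ _ ⟨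
      a * 2# ^ n * 2⁻¹ ^ n   ≈⟨ *-congʳ a2ⁿ≈0 ⟩
      0# * 2⁻¹ ^ n           ≈⟨ zeroˡ _ ⟩
      0#                     ∎
      where open SetoidReasoning setoid

    enrichedFamily : ∃ Comp → Carrierᴹ
    enrichedFamily (n , α) = enriched α

    -- The coordinate at α of a relation involves only α and indices longer than α,
    -- so its coefficients vanish by downward induction on length.

    enriched-independent : LinearlyIndependent N enrichedFamily
    enriched-independent ts distinct combination≈0 = All.tabulate (λ t∈ →
      vanishes (suc maxLength) t∈ (ℕ.m≤m+n (suc maxLength) _))
      where
      termLength : Carrier × ∃ Comp → ℕ
      termLength (_ , _ , α) = ℓ α

      maxLength : ℕ
      maxLength = max 0 (map termLength ts)

      -- `d` is fuel for the downward induction: longer indices need less of it, and `suc maxLength`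
      -- is enough for every length. At `zero` the bound would make `α` longer than every index in
      -- `ts`.
      vanishes : ∀ d {a n} {α : Comp n} → (a , n , α) ∈ ts → maxLength < d ℕ.+ ℓ α → a ≈ 0#
      vanishes zero t∈ max<ℓ = contradiction
        (All.lookup (xs≤max 0 (map termLength ts)) (∈-map⁺ termLength t∈)) (ℕ.<⇒≱ max<ℓ)
      vanishes (suc d) {a} {n} {α} t∈ max<d+ℓ = *2ⁿ-cancel a (ℓ α) (begin
        a * 2# ^ ℓ α                                ≈⟨ *-congˡ (coordinate-enriched-≡ α) ⟨
        a * coordinate α (enriched α)               ≈⟨ coordinate-*ₗ α a (enriched α) ⟨
        coordinate α (a *ₗ enriched α)              ≈⟨ coordinate-extract α
          (λ (c , i) → c *ₗ enrichedFamily i) proj₂ t∈ (AllPairs.map⁻ distinct) others ⟨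
        coordinate α (combination N enrichedFamily ts) ≈⟨ coordinate-cong α combination≈0 ⟩
        coordinate α 0ᴹ                             ≈⟨ IsSubmodule.0-closed (kernel α) ⟩
        0#                                          ∎)
        where
        open SetoidReasoning setoid

        others : ∀ {t} → t ∈ ts → proj₂ t ≢ (n , α) →
                 coordinate α (proj₁ t *ₗ enrichedFamily (proj₂ t)) ≈ 0#
        others {b , p , β} u∈ β≢α with ℓ β ℕ.≤? ℓ α
        ... | yes ℓβ≤ℓα = IsSubmodule.*-closed (kernel α) b
          (coordinate-enriched-≢ β α (β≢α ∘ index-≡ {α = β} {β = α}) ℓβ≤ℓα)
        -- Here the coefficient `b` vanishes by recursion. The unit of fuel spent is made up by the
        -- greater length: `suc d + ℓ α ≤ d + ℓ β`.
        ... | no  ℓβ≰ℓα = ≈-trans (coordinate-*ₗ α b _) (≈-trans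
          (*-congʳ (vanishes d u∈ (ℕ.<-≤-trans
            (subst (maxLength <_) (sym (ℕ.+-suc d (ℓ α))) max<d+ℓ)
            (ℕ.+-monoʳ-≤ d (ℕ.≰⇒> ℓβ≰ℓα)))))
          (zeroˡ _))

    -- Up to multiples of `e β` with `β` shorter, which are in the span by induction, `enriched α`
    -- is `2# ^ ℓ α *ₗ e α`. Subtracting them and dividing by the power of 2 leaves `e α`. The
    -- strict bound `d` on the length makes the recursion structural.
    inSpan-enriched : ∀ d (α : Comp n) → ℓ α < d → InSpan N enrichedFamily (e α)
    inSpan-enriched (suc d) α (s≤s ℓα≤d)
      with v , v∈ , eq ← sum-extract N (span-isSubmodule N enrichedFamily) summand id
        (refinements-refl α) (refinements-unique α)
        (λ {β} β∈ β≢α → *ₗ-inSpan N enrichedFamily (2# ^ ℓ β) (inSpan-enriched d β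
          (ℕ.<-≤-trans
            (ℕ.≰⇒> (β≢α ∘ coarsest α β (refinements-⊆ α β∈))) ℓα≤d))) =
      inSpan-cancel-*ₗ N enrichedFamily (2⁻ⁿ*2ⁿ≈1 (ℓ α))
        (inSpan-cancel-+ N enrichedFamily eq (generator-inSpan N enrichedFamily (_ , α)) v∈)

    enriched-spanning : Spanning N enrichedFamily
    enriched-spanning v = InSpan-resp-≈ N enrichedFamily (expansion v)
      (sum-closed N span (component v) (upTo (suc (proj₁ (bounded v)))) (λ {n} _ →
        sum-closed N span (λ α → coordinate α v *ₗ e α) (compositions n) (λ {α} _ →
          *ₗ-inSpan N enrichedFamily (coordinate α v) (inSpan-enriched _ α ℕ.≤-refl))))
      where span = span-isSubmodule N enrichedFamily

    enriched-isBasis : IsBasis N enrichedFamily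
    enriched-isBasis = enriched-independent , enriched-spanning

-- Coefficients at words as coordinates on QSym

module _ {c ℓ′} (k : CommutativeRing c ℓ′) where
  open CommutativeRing k using (Carrier; _≈_; 0#; 1#; +-monoid)
    renaming (refl to ≈-refl; sym to ≈-sym; trans to ≈-trans)
  open PowerSeries
  open Module (QSym k) using (Carrierᴹ)
  open Mult +-monoid using (×-congˡ; ×-homo-1)

  coordinate : Comp n → Carrierᴹ → Carrier
  coordinate γ (f , _) = coeff f (word γ)

  -- `m` arises from `word (content m)` by moving the variables to increasing indices, so shift
  -- invariance applies. Hence the coordinates determine every coefficient, which gives
  -- `separating`.
  coeff-content : ∀ (v : Carrierᴹ) m → coeff (proj₁ v) m ≈ coordinate (content m) v
  coeff-content (f , _ , shift) m with occurs j↑ j≈ ← content-occurs m =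
    ≈-trans (coeff-cong f (λ k → trans (sym (spread-≈ m k)) (sym (j≈ k))))
      (≈-sym (shift (vector (content m)) _ j↑))

  M-isCoordinateSystem : IsCoordinateSystem (QSym k) (M k) coordinate
  M-isCoordinateSystem = record
    { coordinate-cong = λ γ u≈v → u≈v (word γ)
    ; coordinate-+    = λ _ _ _ → ≈-refl
    ; coordinate-*ₗ   = λ _ _ _ → ≈-refl
    ; coordinate-≡    = λ α → ≈-trans (×-congˡ (count-word-≡ α)) (×-homo-1 1#)
    ; coordinate-≢    = λ α γ α≢γ → ×-congˡ (count-word-≢ α γ α≢γ)
    ; bounded         = λ (_ , (d , f≈0) , _) →
        d , λ γ d<n → f≈0 (word γ) (subst (d <_) (sym (degree-word γ)) d<n)
    ; separating      = λ {u} {v} u≈v m → ≈-trans (coeff-content u m)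
        (≈-trans (u≈v (content m)) (≈-sym (coeff-content v m)))
    }

theorem1 : ∀ {c ℓ′} (k : CommutativeRing c ℓ′) → let open CommutativeRing k in
    Invertible _≈_ 1# _*_ (1# + 1#) →
    IsBasis (QSym k) {I = ∃ Comp} (λ (n , α) → η k α)
-- For this coordinate system `enriched` unfolds to `η k`, so the general result applies without
-- conversion.
theorem1 k (_ , 2⁻¹*2≈1 , _) = enriched-isBasis (QSym k) (M-isCoordinateSystem k) 2⁻¹*2≈1
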